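{- Let $\mathsf{L}$ be one of classical predicate logic $\mathsf{CQC}$, intuitionistic predicate logic $\mathsf{IQC}$, or minimal predicate logic $\mathsf{MQC}$, and let $j$ be a nucleus relative to $\mathsf{L}$. Let $\varphi^j$ (Gödel-Gentzen-style translation), $J\varphi$ and $\varphi_j := j(J\varphi)$ (Kuroda-style translation) be as defined in the context. Then: (a) For every formula $\varphi$ we have $\vdash_{\mathsf{L}} \varphi^j \leftrightarrow \varphi_j$. (b) For all formulas $\varphi_1,\ldots,\varphi_n,\psi$: if $\varphi_1,\ldots,\varphi_n \vdash_{\mathsf{L}} \psi$, then $J(\varphi_1),\ldots,J(\varphi_n) \vdash_{\mathsf{L}} \psi_j$.
   Context: Logics. Formulas are formulas of predicate logic built with $\land,\lor,\to,\exists,\forall,\bot$ as primitives, where $\lnot\varphi$ abbreviates $\varphi\to\bot$ and $\varphi\leftrightarrow\psi$ abbreviates $(\varphi\to\psi)\land(\psi\to\varphi)$. $\mathsf{MQC}$ (minimal predicate logic) is axiomatised in natural deduction style by the standard introduction and elimination rules for $\land,\lor,\to,\exists,\forall$, with "$\varphi$ follows from $\varphi$" as the only axiom; in it $\bot$ has no special properties and acts as an arbitrary propositional constant. $\mathsf{IQC}$ is $\mathsf{MQC}$ plus ex falso $\bot\to\varphi$. $\mathsf{CQC}$ is $\mathsf{IQC}$ plus excluded middle $\varphi\lor\lnot\varphi$ (equivalently $\lnot\lnot\varphi\to\varphi$). $\varphi_1,\ldots,\varphi_n\vdash_{\mathsf{L}}\psi$ means that $\psi$ is derivable in $\mathsf{L}$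 from the assumptions $\varphi_1,\ldots,\varphi_n$ (formulas may have free variables). Nucleus. A function $j$ mapping formulas to formulas is a nucleus relative to $\mathsf{L}$ if for all formulas $\varphi,\psi$ (and all variables $x$ and terms $t$, with capture-avoiding substitution $[t/x]$): - $\vdash_{\mathsf{L}} \varphi\to j\varphi$; - $\vdash_{\mathsf{L}} j(\varphi\land\psi)\leftrightarrow(j\varphi\land j\psi)$; - $\vdash_{\mathsf{L}} (\varphi\to j\psi)\to(j\varphi\to j\psi)$; - $\vdash_{\mathsf{L}} (j\varphi)[t/x]\leftrightarrow j(\varphi[t/x])$. Gödel-Gentzen-style $j$-translation. $\varphi^j$ is defined by induction on $\varphi$: - $\varphi^j := j\varphi$ if $\varphi$ is atomic ($\bot$ counts as atomic); - $(\varphi\land\psi)^j := \varphi^j\land\psi^j$; - $(\varphi\lor\psi)^j := j(\varphi^j\lor\psi^j)$; - $(\varphi\to\psi)^j := \varphi^j\to\psi^j$; - $(\exists x\,\varphi)^j := j(\exists x\,\varphi^j)$; - $(\forall x\,\varphi)^j := \forall x\,\varphi^j$. Kuroda-style $j$-translation. $J\varphi$ is defined by induction on $\varphi$: - $J\varphi := \varphi$ if $\varphi$ is atomic ($\bot$ counts as atomic); - $J(\varphi\land\psi) := J\varphi\land J\psi$; - $J(\varphi\lor\psi) := J\varphi\lor J\psi$; - $J(\varphi\to\psi) := J\varphi\to j(J\psi)$; - $J(\exists x\,\varphi) := \exists x\,J\varphi$; - $J(\forall x\,\varphi) := \forall x\,j(J\varphi)$. Finally $\varphi_j := j(J\varphi)$.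 -}

module Defs where

open import Data.List using (List; []; _∷_; _++_; concatMap; filter)
open import Data.List.Extrema.Nat using (max)
open import Data.List.Membership.Propositional using (_∈_; _∉_)
open import Data.List.Relation.Binary.Subset.Propositional using (_⊆_)
open import Data.List.Relation.Unary.All using (All)
open import Data.Nat using (ℕ; suc; _≟_)
open import Data.List.Membership.DecPropositional _≟_ using (_∈?_)
open import Data.Vec using (Vec; []; _∷_)
open import Relation.Nullary using (yes; no)
open import Relation.Nullary.Decidable using (¬?)

record Signature : Set₁ where
  field
    Fun   : Set
    Rel   : Set
    funAr : Fun → ℕ
    relAr : Rel → ℕ

open Signature public

Var : Set
Var = ℕ

data Term (S : Signature) : Set where
  var : Var → Term S
  fun : (f : Fun S) → Vec (Term S) (funAr S f) → Term S

infixr 7 _∧_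
infixr 6 _∨_
infixr 5 _⇒_
infix  4 _⇔_

-- Raw formulas with named variables: formulas differing in the names of bound
-- variables are distinct, and so may be treated differently by a map j.
data Formula (S : Signature) : Set where
  rel         : (R : Rel S) → Vec (Term S) (relAr S R) → Formula S
  ⊥           : Formula S
  _∧_ _∨_ _⇒_ : Formula S → Formula S → Formula S
  ∃′ ∀′       : Var → Formula S → Formula S

private variable
  S : Signature
  n : ℕ

¬′_ : Formula S → Formula S
¬′ φ = φ ⇒ ⊥

_⇔_ : Formula S → Formula S → Formula S
φ ⇔ ψ = (φ ⇒ ψ) ∧ (ψ ⇒ φ)

mutual
  fvTerm : Term S → List Var
  fvTerm (var x)    = x ∷ []
  fvTerm (fun f ts) = fvTerms ts

  fvTerms : Vec (Term S) n → List Var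
  fvTerms []       = []
  fvTerms (t ∷ ts) = fvTerm t ++ fvTerms ts

remove : Var → List Var → List Var
remove x = filter (λ y → ¬? (y ≟ x))

fv : Formula S → List Var
fv (rel R ts) = fvTerms ts
fv ⊥          = []
fv (φ ∧ ψ)    = fv φ ++ fv ψ
fv (φ ∨ ψ)    = fv φ ++ fv ψ
fv (φ ⇒ ψ)    = fv φ ++ fv ψ
fv (∃′ x φ)   = remove x (fv φ)
fv (∀′ x φ)   = remove x (fv φ)

Subst : Signature → Set
Subst S = Var → Term S

_[_↦_] : Subst S → Var → Term S → Subst S
(σ [ x ↦ t ]) y with y ≟ x
... | yes _ = t
... | no  _ = σ y

mutual
  substTerm : Subst S → Term S → Term S
  substTerm σ (var x)    = σ x
  substTerm σ (fun f ts) = fun f (substTerms σ ts)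

  substTerms : Subst S → Vec (Term S) n → Vec (Term S) n
  substTerms σ []       = []
  substTerms σ (t ∷ ts) = substTerm σ t ∷ substTerms σ ts

-- The name given to the variable x bound over φ when σ is applied: x itself
-- unless some term substituted for a free variable of the quantified formula
-- would be captured, and otherwise a variable occurring in no such term.
binder : Subst S → Var → Formula S → Var
binder σ x φ = choose (concatMap (λ z → fvTerm (σ z)) (remove x (fv φ)))
  where
  choose : List Var → Var
  choose avoid with x ∈? avoid
  ... | yes _ = suc (max 0 avoid)
  ... | no  _ = x

subst : Subst S → Formula S → Formula S
subst σ (rel R ts) = rel R (substTerms σ ts)
subst σ ⊥          = ⊥
subst σ (φ ∧ ψ)    = subst σ φ ∧ subst σ ψ
subst σ (φ ∨ ψ)    = subst σ φ ∨ subst σ ψ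
subst σ (φ ⇒ ψ)    = subst σ φ ⇒ subst σ ψ
subst σ (∃′ x φ)   = ∃′ (binder σ x φ) (subst (σ [ x ↦ var (binder σ x φ) ]) φ)
subst σ (∀′ x φ)   = ∀′ (binder σ x φ) (subst (σ [ x ↦ var (binder σ x φ) ]) φ)

infix 8 _[_/_]

_[_/_] : Formula S → Term S → Var → Formula S
φ [ t / x ] = subst (var [ x ↦ t ]) φ

data Logic : Set where
  CQC IQC MQC : Logic

data Axiom {S : Signature} : Logic → Formula S → Set where
  exFalsoᴵ : ∀ {φ} → Axiom IQC (⊥ ⇒ φ)
  exFalsoᶜ : ∀ {φ} → Axiom CQC (⊥ ⇒ φ)
  lem      : ∀ {φ} → Axiom CQC (φ ∨ ¬′ φ)

infix 3 _⊢[_]_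

-- Γ contains the open assumptions of a derivation.  The rule `weaken' makes
-- the eigenvariable conditions of ∀I and ∃E concern only those assumptions
-- that are actually used, as in natural deduction with derivation trees.
data _⊢[_]_ {S : Signature} : List (Formula S) → Logic → Formula S → Set where
  assume : ∀ {L Γ φ} → φ ∈ Γ → Γ ⊢[ L ] φ
  axm    : ∀ {L Γ φ} → Axiom L φ → Γ ⊢[ L ] φ
  weaken : ∀ {L Γ Δ φ} → Γ ⊆ Δ → Γ ⊢[ L ] φ → Δ ⊢[ L ] φ
  ∧I     : ∀ {L Γ φ ψ} → Γ ⊢[ L ] φ → Γ ⊢[ L ] ψ → Γ ⊢[ L ] φ ∧ ψ
  ∧E₁    : ∀ {L Γ φ ψ} → Γ ⊢[ L ] φ ∧ ψ → Γ ⊢[ L ] φ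
  ∧E₂    : ∀ {L Γ φ ψ} → Γ ⊢[ L ] φ ∧ ψ → Γ ⊢[ L ] ψ
  ∨I₁    : ∀ {L Γ φ ψ} → Γ ⊢[ L ] φ → Γ ⊢[ L ] φ ∨ ψ
  ∨I₂    : ∀ {L Γ φ ψ} → Γ ⊢[ L ] ψ → Γ ⊢[ L ] φ ∨ ψ
  ∨E     : ∀ {L Γ φ ψ χ} → Γ ⊢[ L ] φ ∨ ψ → φ ∷ Γ ⊢[ L ] χ → ψ ∷ Γ ⊢[ L ] χ →
           Γ ⊢[ L ] χ
  ⇒I     : ∀ {L Γ φ ψ} → φ ∷ Γ ⊢[ L ] ψ → Γ ⊢[ L ] φ ⇒ ψ
  ⇒E     : ∀ {L Γ φ ψ} → Γ ⊢[ L ] φ ⇒ ψ → Γ ⊢[ L ] φ → Γ ⊢[ L ] ψ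
  ∃I     : ∀ {L Γ x φ} (t : Term S) → Γ ⊢[ L ] φ [ t / x ] → Γ ⊢[ L ] ∃′ x φ
  ∃E     : ∀ {L Γ x φ ψ} → All (λ γ → x ∉ fv γ) Γ → x ∉ fv ψ →
           Γ ⊢[ L ] ∃′ x φ → φ ∷ Γ ⊢[ L ] ψ → Γ ⊢[ L ] ψ
  ∀I     : ∀ {L Γ x φ} → All (λ γ → x ∉ fv γ) Γ → Γ ⊢[ L ] φ → Γ ⊢[ L ] ∀′ x φ
  ∀E     : ∀ {L Γ x φ} (t : Term S) → Γ ⊢[ L ] ∀′ x φ → Γ ⊢[ L ] φ [ t / x ]

record IsNucleus {S : Signature} (L : Logic) (j : Formula S → Formula S) : Set where
  field
    unit     : ∀ φ → [] ⊢[ L ] φ ⇒ j φ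
    conj     : ∀ φ ψ → [] ⊢[ L ] j (φ ∧ ψ) ⇔ (j φ ∧ j ψ)
    bind     : ∀ φ ψ → [] ⊢[ L ] (φ ⇒ j ψ) ⇒ (j φ ⇒ j ψ)
    commutes : ∀ φ x t → [] ⊢[ L ] (j φ) [ t / x ] ⇔ j (φ [ t / x ])

module _ {S : Signature} (j : Formula S → Formula S) where

  gödelGentzen : Formula S → Formula S
  gödelGentzen (rel R ts) = j (rel R ts)
  gödelGentzen ⊥          = j ⊥
  gödelGentzen (φ ∧ ψ)    = gödelGentzen φ ∧ gödelGentzen ψ
  gödelGentzen (φ ∨ ψ)    = j (gödelGentzen φ ∨ gödelGentzen ψ)
  gödelGentzen (φ ⇒ ψ)    = gödelGentzen φ ⇒ gödelGentzen ψ
  gödelGentzen (∃′ x φ)   = j (∃′ x (gödelGentzen φ))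
  gödelGentzen (∀′ x φ)   = ∀′ x (gödelGentzen φ)

  J : Formula S → Formula S
  J (rel R ts) = rel R ts
  J ⊥          = ⊥
  J (φ ∧ ψ)    = J φ ∧ J ψ
  J (φ ∨ ψ)    = J φ ∨ J ψ
  J (φ ⇒ ψ)    = J φ ⇒ j (J ψ)
  J (∃′ x φ)   = ∃′ x (J φ)
  J (∀′ x φ)   = ∀′ x (j (J φ))

  kuroda : Formula S → Formula S
  kuroda φ = j (J φ)

{-# OPTIONS --safe #-}

-- Part (a) is an induction on formulas using only the nucleus laws, and part
-- (b) an induction on derivations.  The difficulty is with variables: j φ and
-- J φ may contain free variables that φ lacks, so the translation of an
-- eigenvariable condition can fail literally.  It survives up to provable
-- equivalence: if x is not free in φ then j φ is equivalent to (j φ)[t/x], in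
-- which x is not free when t does not contain it.  The same for J φ, and the
-- rules ∃I and ∀E, need that J commutes with substitution up to provable
-- equivalence.  Since substitution renames bound variables, this is shown by
-- induction on depth simultaneously with the invariance of J under
-- α-equivalence.

module Submission where

open import Defs
open import Data.Empty using (⊥-elim)
open import Data.List using (List; []; _∷_; _++_; concatMap; map)
open import Data.List.Extrema.Nat using (max; xs≤max)
open import Data.List.Membership.Propositional using (_∈_; _∉_; find; lose)
open import Data.List.Membership.Propositional.Properties
  using (∈-++⁺ˡ; ∈-++⁺ʳ; ∈-++⁻; ∈-filter⁺; ∈-filter⁻; ∈-concatMap⁺; ∈-concatMap⁻; ∈-map⁺)
open import Data.List.Properties using (concatMap-cong)
open import Data.List.Relation.Binary.Subset.Propositional.Properties using (map⁺; ∷⁺ʳ)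
open import Data.List.Relation.Unary.All as All using (All; []; _∷_)
open import Data.List.Relation.Unary.All.Properties using () renaming (map⁺ to All-map⁺)
open import Data.List.Relation.Unary.Any using (here; there)
open import Data.Nat using (ℕ; zero; suc; _≟_; _≤_; s≤s; _⊔_)
open import Data.List.Membership.DecPropositional _≟_ using (_∈?_)
open import Data.Nat.Properties using (≤-refl; 1+n≢n; 1+n≰n; m⊔n≤o⇒m≤o; m⊔n≤o⇒n≤o)
open import Data.Product using (∃-syntax; _×_; _,_; proj₁; proj₂)
open import Data.Sum using (inj₁; inj₂)
open import Data.Vec using (Vec; []; _∷_)
open import Function using (_∘_)
open import Relation.Binary.PropositionalEquality as ≡
  using (_≡_; _≢_; _≗_; refl; sym; trans; cong; cong₂)
open import Relation.Nullary using (yes; no; ¬?)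

private variable
  S : Signature
  L : Logic
  n : ℕ
  u v w x y z : Var
  xs : List Var
  s t : Term S
  ts ss : Vec (Term S) n
  e e′ f f′ θ σ τ : Subst S
  φ φ′ ψ ψ′ χ : Formula S
  Γ Δ : List (Formula S)

-- Variables

∈-remove⁺ : v ≢ x → v ∈ xs → v ∈ remove x xs
∈-remove⁺ {x = x} v≢x v∈ = ∈-filter⁺ (λ y → ¬? (y ≟ x)) v∈ v≢x

∈-remove⁻ : ∀ xs → v ∈ remove x xs → v ∈ xs × v ≢ x
∈-remove⁻ {x = x} xs = ∈-filter⁻ (λ y → ¬? (y ≟ x)) {xs = xs}

∉-remove : ∀ xs → x ∉ remove x xs
∉-remove xs x∈ = proj₂ (∈-remove⁻ xs x∈) refl

∉-remove-mono : ∀ xs → x ∉ xs → x ∉ remove y xs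
∉-remove-mono xs x∉ = x∉ ∘ proj₁ ∘ ∈-remove⁻ xs

∈-singleton : v ∈ x ∷ [] → v ≡ x
∈-singleton (here v≡x) = v≡x

suc-max∉ : ∀ xs → suc (max 0 xs) ∉ xs
suc-max∉ xs m∈ = 1+n≰n (All.lookup (xs≤max 0 xs) m∈)

-- Substitution in terms

update-same : ∀ (σ : Subst S) x t → (σ [ x ↦ t ]) x ≡ t
update-same σ x t with x ≟ x
... | yes _   = refl
... | no  x≢x = ⊥-elim (x≢x refl)

update-other : ∀ (σ : Subst S) t → v ≢ x → (σ [ x ↦ t ]) v ≡ σ v
update-other {v = v} {x = x} σ t v≢x with v ≟ x
... | yes v≡x = ⊥-elim (v≢x v≡x)
... | no  _   = refl

mutual
  substTerm-id : ∀ (t : Term S) → (∀ {v} → v ∈ fvTerm t → σ v ≡ var v) → substTerm σ t ≡ t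
  substTerm-id (var x)    h = h (here refl)
  substTerm-id (fun f ts) h = cong (fun f) (substTerms-id ts h)

  substTerms-id : ∀ (ts : Vec (Term S) n) → (∀ {v} → v ∈ fvTerms ts → σ v ≡ var v) →
                  substTerms σ ts ≡ ts
  substTerms-id []       h = refl
  substTerms-id (t ∷ ts) h =
    cong₂ _∷_ (substTerm-id t (h ∘ ∈-++⁺ˡ)) (substTerms-id ts (h ∘ ∈-++⁺ʳ (fvTerm t)))

mutual
  -- The hypothesis concerns only the variables of `t`, so congruence and commuting squares of
  -- substitutions follow from it as well as composition.
  substTerm-fuse : ∀ (t : Term S) → (∀ {v} → v ∈ fvTerm t → σ v ≡ substTerm θ (e v)) →
                   substTerm σ t ≡ substTerm θ (substTerm e t)
  substTerm-fuse (var x)    h = h (here refl)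
  substTerm-fuse (fun f ts) h = cong (fun f) (substTerms-fuse ts h)

  substTerms-fuse : ∀ (ts : Vec (Term S) n) →
                    (∀ {v} → v ∈ fvTerms ts → σ v ≡ substTerm θ (e v)) →
                    substTerms σ ts ≡ substTerms θ (substTerms e ts)
  substTerms-fuse []       h = refl
  substTerms-fuse (t ∷ ts) h =
    cong₂ _∷_ (substTerm-fuse t (h ∘ ∈-++⁺ˡ)) (substTerms-fuse ts (h ∘ ∈-++⁺ʳ (fvTerm t)))

substTerm-var : (t : Term S) → substTerm var t ≡ t
substTerm-var t = substTerm-id t (λ _ → refl)

substTerm-square : ∀ (t : Term S) →
                   (∀ {v} → v ∈ fvTerm t → substTerm f (σ v) ≡ substTerm θ (e v)) →
                   substTerm f (substTerm σ t) ≡ substTerm θ (substTerm e t)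
substTerm-square t h = trans (sym (substTerm-fuse t (λ _ → refl))) (substTerm-fuse t h)

substTerms-square : ∀ (ts : Vec (Term S) n) →
                    (∀ {v} → v ∈ fvTerms ts → substTerm f (σ v) ≡ substTerm θ (e v)) →
                    substTerms f (substTerms σ ts) ≡ substTerms θ (substTerms e ts)
substTerms-square ts h = trans (sym (substTerms-fuse ts (λ _ → refl))) (substTerms-fuse ts h)

substTerm-cong : ∀ (t : Term S) → (∀ {v} → v ∈ fvTerm t → σ v ≡ τ v) →
                 substTerm σ t ≡ substTerm τ t
substTerm-cong t h =
  trans (substTerm-fuse t (λ v∈ → trans (h v∈) (sym (substTerm-var _)))) (substTerm-var _)

substTerms-cong : ∀ (ts : Vec (Term S) n) → (∀ {v} → v ∈ fvTerms ts → σ v ≡ τ v) →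
                  substTerms σ ts ≡ substTerms τ ts
substTerms-cong ts h =
  trans (substTerms-fuse ts (λ v∈ → trans (h v∈) (sym (substTerm-var _))))
        (substTerms-id _ (λ _ → refl))

mutual
  fvTerm-subst : ∀ (t : Term S) → v ∈ fvTerm (substTerm σ t) →
                 ∃[ u ] (u ∈ fvTerm t × v ∈ fvTerm (σ u))
  fvTerm-subst (var x)    v∈ = x , here refl , v∈
  fvTerm-subst (fun f ts) v∈ = fvTerms-subst ts v∈

  fvTerms-subst : ∀ (ts : Vec (Term S) n) → v ∈ fvTerms (substTerms σ ts) →
                  ∃[ u ] (u ∈ fvTerms ts × v ∈ fvTerm (σ u))
  fvTerms-subst {σ = σ} (t ∷ ts) v∈ with ∈-++⁻ (fvTerm (substTerm σ t)) v∈
  ... | inj₁ v∈t  = let u , u∈ , v∈σu = fvTerm-subst t v∈t in u , ∈-++⁺ˡ u∈ , v∈σu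
  ... | inj₂ v∈ts = let u , u∈ , v∈σu = fvTerms-subst ts v∈ts in
                    u , ∈-++⁺ʳ (fvTerm t) u∈ , v∈σu

-- Substitution in formulas

binder-unchanged : ∀ (φ : Formula S) →
                   (∀ {v} → v ∈ fv φ → v ≢ x → x ∉ fvTerm (σ v)) → binder σ x φ ≡ x
binder-unchanged {x = x} {σ = σ} φ h
  with x ∈? concatMap (λ z → fvTerm (σ z)) (remove x (fv φ))
... | no  _  = refl
... | yes x∈ with find (∈-concatMap⁻ (fvTerm ∘ σ) {xs = remove x (fv φ)} x∈)
...   | v , v∈ , x∈σv = let v∈φ , v≢x = ∈-remove⁻ (fv φ) v∈ in ⊥-elim (h v∈φ v≢x x∈σv)

-- A kept name has passed the membership test, and a new one exceeds every variable to be avoided.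
binder-avoids : ∀ (σ : Subst S) x φ → v ∈ fv φ → v ≢ x → binder σ x φ ∉ fvTerm (σ v)
binder-avoids σ x φ v∈ v≢x b∈
  with x ∈? concatMap (λ z → fvTerm (σ z)) (remove x (fv φ))
     | ∈-concatMap⁺ (fvTerm ∘ σ) {xs = remove x (fv φ)} (lose (∈-remove⁺ v≢x v∈) b∈)
... | yes _ | b∈avoid = suc-max∉ (concatMap (fvTerm ∘ σ) (remove x (fv φ))) b∈avoid
... | no x∉ | b∈avoid = x∉ b∈avoid

binder-cong : σ ≗ τ → ∀ x (φ : Formula S) → binder σ x φ ≡ binder τ x φ
binder-cong {τ = τ} σ≗τ x φ
  rewrite concatMap-cong (cong fvTerm ∘ σ≗τ) (remove x (fv φ))
  with x ∈? concatMap (λ z → fvTerm (τ z)) (remove x (fv φ))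
... | yes _ = refl
... | no  _ = refl

update-cong : σ ≗ τ → ∀ x (t : Term S) → (σ [ x ↦ t ]) ≗ (τ [ x ↦ t ])
update-cong σ≗τ x t v with v ≟ x
... | yes _ = refl
... | no  _ = σ≗τ v

subst-cong : σ ≗ τ → (φ : Formula S) → subst σ φ ≡ subst τ φ
subst-cong σ≗τ (rel R ts) = cong (rel R) (substTerms-cong ts (λ {v} _ → σ≗τ v))
subst-cong σ≗τ ⊥          = refl
subst-cong σ≗τ (φ ∧ ψ)    = cong₂ _∧_ (subst-cong σ≗τ φ) (subst-cong σ≗τ ψ)
subst-cong σ≗τ (φ ∨ ψ)    = cong₂ _∨_ (subst-cong σ≗τ φ) (subst-cong σ≗τ ψ)
subst-cong σ≗τ (φ ⇒ ψ)    = cong₂ _⇒_ (subst-cong σ≗τ φ) (subst-cong σ≗τ ψ)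
subst-cong σ≗τ (∃′ x φ) rewrite binder-cong σ≗τ x φ =
  cong (∃′ _) (subst-cong (update-cong σ≗τ x _) φ)
subst-cong σ≗τ (∀′ x φ) rewrite binder-cong σ≗τ x φ =
  cong (∀′ _) (subst-cong (update-cong σ≗τ x _) φ)

update-id : (∀ {v} → v ∈ remove x xs → σ v ≡ var {S} v) →
            ∀ {v} → v ∈ xs → (σ [ x ↦ var x ]) v ≡ var v
update-id {x = x} h {v} v∈ with v ≟ x
... | yes refl = refl
... | no  v≢x  = h (∈-remove⁺ v≢x v∈)

binder-id : ∀ (φ : Formula S) → (∀ {v} → v ∈ remove x (fv φ) → σ v ≡ var v) → binder σ x φ ≡ x
binder-id {σ = σ} φ h = binder-unchanged {σ = σ} φ λ v∈ v≢x x∈ →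
  v≢x (sym (∈-singleton (≡.subst (λ s → _ ∈ fvTerm s) (h (∈-remove⁺ v≢x v∈)) x∈)))

-- Equality is literal here: each free variable is replaced by itself, so no binder is threatened
-- with capture and none is renamed.
subst-id : (φ : Formula S) → (∀ {v} → v ∈ fv φ → σ v ≡ var v) → subst σ φ ≡ φ
subst-id (rel R ts) h = cong (rel R) (substTerms-id ts h)
subst-id ⊥          h = refl
subst-id (φ ∧ ψ)    h = cong₂ _∧_ (subst-id φ (h ∘ ∈-++⁺ˡ)) (subst-id ψ (h ∘ ∈-++⁺ʳ (fv φ)))
subst-id (φ ∨ ψ)    h = cong₂ _∨_ (subst-id φ (h ∘ ∈-++⁺ˡ)) (subst-id ψ (h ∘ ∈-++⁺ʳ (fv φ)))
subst-id (φ ⇒ ψ)    h = cong₂ _⇒_ (subst-id φ (h ∘ ∈-++⁺ˡ)) (subst-id ψ (h ∘ ∈-++⁺ʳ (fv φ)))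
subst-id {σ = σ} (∃′ x φ) h rewrite binder-id {σ = σ} φ h = cong (∃′ x) (subst-id φ (update-id h))
subst-id {σ = σ} (∀′ x φ) h rewrite binder-id {σ = σ} φ h = cong (∀′ x) (subst-id φ (update-id h))

[var-self] : ∀ (φ : Formula S) x → φ [ var x / x ] ≡ φ
[var-self] φ x = subst-id φ (update-id {xs = fv φ} (λ _ → refl))

[]-not-free : ∀ (φ : Formula S) t → x ∉ fv φ → φ [ t / x ] ≡ φ
[]-not-free φ t x∉ = subst-id φ λ v∈ → update-other var t λ { refl → x∉ v∈ }

fv-update : ∀ (σ : Subst S) → v ≢ w → u ∈ xs → v ∈ fvTerm ((σ [ x ↦ var w ]) u) →
            ∃[ u ] (u ∈ remove x xs × v ∈ fvTerm (σ u))
fv-update {u = u} {x = x} σ v≢w u∈ v∈ with u ≟ x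
... | yes _  = ⊥-elim (v≢w (∈-singleton v∈))
... | no u≢x = u , ∈-remove⁺ u≢x u∈ , v∈

fv-subst : ∀ (φ : Formula S) → v ∈ fv (subst σ φ) → ∃[ u ] (u ∈ fv φ × v ∈ fvTerm (σ u))
fv-subst-++ : ∀ (φ ψ : Formula S) → v ∈ fv (subst σ φ) ++ fv (subst σ ψ) →
              ∃[ u ] (u ∈ fv φ ++ fv ψ × v ∈ fvTerm (σ u))

fv-subst (rel R ts) v∈ = fvTerms-subst ts v∈
fv-subst (φ ∧ ψ)    v∈ = fv-subst-++ φ ψ v∈
fv-subst (φ ∨ ψ)    v∈ = fv-subst-++ φ ψ v∈
fv-subst (φ ⇒ ψ)    v∈ = fv-subst-++ φ ψ v∈
fv-subst {σ = σ} (∃′ x φ) v∈ =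
  let v∈φ′ , v≢b = ∈-remove⁻ (fv (subst _ φ)) v∈
      u , u∈ , v∈u = fv-subst φ v∈φ′
  in fv-update σ v≢b u∈ v∈u
fv-subst {σ = σ} (∀′ x φ) v∈ =
  let v∈φ′ , v≢b = ∈-remove⁻ (fv (subst _ φ)) v∈
      u , u∈ , v∈u = fv-subst φ v∈φ′
  in fv-update σ v≢b u∈ v∈u

fv-subst-++ {σ = σ} φ ψ v∈ with ∈-++⁻ (fv (subst σ φ)) v∈
... | inj₁ v∈φ = let u , u∈ , v∈u = fv-subst φ v∈φ in u , ∈-++⁺ˡ u∈ , v∈u
... | inj₂ v∈ψ = let u , u∈ , v∈u = fv-subst ψ v∈ψ in u , ∈-++⁺ʳ (fv φ) u∈ , v∈u

∉-fv-[] : ∀ (φ : Formula S) t → x ∉ fvTerm t → x ∉ fv (φ [ t / x ])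
∉-fv-[] {x = x} φ t x∉t x∈ with fv-subst φ x∈
... | u , _ , x∈u with u ≟ x
...   | yes _  = x∉t x∈u
...   | no u≢x = u≢x (sym (∈-singleton x∈u))

-- Substitutions that rename no bound variable

bv : Formula S → List Var
bv (rel R ts) = []
bv ⊥          = []
bv (φ ∧ ψ)    = bv φ ++ bv ψ
bv (φ ∨ ψ)    = bv φ ++ bv ψ
bv (φ ⇒ ψ)    = bv φ ++ bv ψ
bv (∃′ x φ)   = x ∷ bv φ
bv (∀′ x φ)   = x ∷ bv φ

vars : Formula S → List Var
vars φ = fv φ ++ bv φ

-- τ puts no bound variable of φ in place of another variable, so that applying
-- it to φ renames nothing.
NoCapture : Subst S → Formula S → Set
NoCapture τ φ = ∀ {v z} → v ∈ fv φ → z ∈ bv φ → z ∈ fvTerm (τ v) → v ≡ z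

_LeftInverseOf_On_ : Subst S → Subst S → List Var → Set
σ LeftInverseOf τ On xs = ∀ {v} → v ∈ xs → substTerm σ (τ v) ≡ var v

private
  -- Substitution keeps a head function symbol, so only a variable can have a variable as its image.
  preimage-var : ∀ (s : Term S) → substTerm σ s ≡ var v → u ∈ fvTerm s → σ u ≡ var v
  preimage-var (var _) eq (here refl) = eq

  -- The quantifier case of `subst-inverse`, shared by `∃′` and `∀′`: neither substitution renames
  -- `x`, and both hypotheses pass to the body.
  module UnderBinder (σ τ : Subst S) (x : Var) (φ : Formula S)
    (nc : ∀ {v z} → v ∈ remove x (fv φ) → z ∈ x ∷ bv φ → z ∈ fvTerm (τ v) → v ≡ z)
    (inv : σ LeftInverseOf τ On remove x (fv φ)) where

    τ′ : Subst S
    τ′ = τ [ x ↦ var x ]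

    x∉τ : v ∈ fv φ → v ≢ x → x ∉ fvTerm (τ v)
    x∉τ v∈ v≢x x∈ = v≢x (nc (∈-remove⁺ v≢x v∈) (here refl) x∈)

    binder-τ : binder τ x φ ≡ x
    binder-τ = binder-unchanged {σ = τ} φ x∉τ

    binder-σ : binder σ x (subst τ′ φ) ≡ x
    -- A free variable `u ≢ x` of the substituted body occurs in `τ v′` for some `v′ ≢ x`. The
    -- inverse property forces `σ u` to be `var v′`, which does not contain `x`.
    binder-σ = binder-unchanged {σ = σ} (subst τ′ φ) λ u∈ u≢x x∈ →
      let v , v∈ , u∈τ′v = fv-subst φ u∈
          v′ , v′∈ , u∈τv′ = fv-update τ u≢x v∈ u∈τ′v
          σu≡v′ = preimage-var (τ v′) (inv v′∈) u∈τv′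
      in proj₂ (∈-remove⁻ (fv φ) v′∈)
           (sym (∈-singleton (≡.subst (λ s → x ∈ fvTerm s) σu≡v′ x∈)))

    noCapture : NoCapture τ′ φ
    noCapture {v} v∈ z∈ z∈τv with v ≟ x
    ... | yes refl = sym (∈-singleton z∈τv)
    ... | no  v≢x  = nc (∈-remove⁺ v≢x v∈) (there z∈) z∈τv

    inverse : (σ [ x ↦ var x ]) LeftInverseOf τ′ On fv φ
    inverse {v} v∈ with v ≟ x
    ... | yes refl = update-same σ x (var x)
    ... | no  v≢x  = trans
      (substTerm-cong (τ v) λ u∈ → update-other σ (var x) λ { refl → x∉τ v∈ v≢x u∈ })
      (inv (∈-remove⁺ v≢x v∈))

subst-inverse : ∀ (φ : Formula S) → NoCapture τ φ → σ LeftInverseOf τ On fv φ →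
                subst σ (subst τ φ) ≡ φ
subst-inverse (rel R ts) nc inv = cong (rel R)
  (trans (sym (substTerms-fuse ts (λ _ → refl))) (substTerms-id ts inv))
subst-inverse ⊥          nc inv = refl
subst-inverse (φ ∧ ψ)    nc inv = cong₂ _∧_
  (subst-inverse φ (λ p q → nc (∈-++⁺ˡ p) (∈-++⁺ˡ q)) (inv ∘ ∈-++⁺ˡ))
  (subst-inverse ψ (λ p q → nc (∈-++⁺ʳ (fv φ) p) (∈-++⁺ʳ (bv φ) q)) (inv ∘ ∈-++⁺ʳ (fv φ)))
subst-inverse (φ ∨ ψ)    nc inv = cong₂ _∨_
  (subst-inverse φ (λ p q → nc (∈-++⁺ˡ p) (∈-++⁺ˡ q)) (inv ∘ ∈-++⁺ˡ))
  (subst-inverse ψ (λ p q → nc (∈-++⁺ʳ (fv φ) p) (∈-++⁺ʳ (bv φ) q)) (inv ∘ ∈-++⁺ʳ (fv φ)))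
subst-inverse (φ ⇒ ψ)    nc inv = cong₂ _⇒_
  (subst-inverse φ (λ p q → nc (∈-++⁺ˡ p) (∈-++⁺ˡ q)) (inv ∘ ∈-++⁺ˡ))
  (subst-inverse ψ (λ p q → nc (∈-++⁺ʳ (fv φ) p) (∈-++⁺ʳ (bv φ) q)) (inv ∘ ∈-++⁺ʳ (fv φ)))
subst-inverse {τ = τ} {σ = σ} (∃′ x φ) nc inv
  rewrite UnderBinder.binder-τ σ τ x φ nc inv | UnderBinder.binder-σ σ τ x φ nc inv =
  cong (∃′ x) (subst-inverse φ (UnderBinder.noCapture σ τ x φ nc inv)
                               (UnderBinder.inverse σ τ x φ nc inv))
subst-inverse {τ = τ} {σ = σ} (∀′ x φ) nc inv
  rewrite UnderBinder.binder-τ σ τ x φ nc inv | UnderBinder.binder-σ σ τ x φ nc inv =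
  cong (∀′ x) (subst-inverse φ (UnderBinder.noCapture σ τ x φ nc inv)
                               (UnderBinder.inverse σ τ x φ nc inv))

-- Freshness of `w` extends to the bound variables: otherwise the first renaming could change a
-- binder that the second does not restore.
rename-inverse : ∀ (φ : Formula S) → w ∉ vars φ → φ [ var w / x ] [ var x / w ] ≡ φ
rename-inverse {S} {w = w} {x = x} φ w∉ = subst-inverse φ noCapture inverse
  where
  noCapture : NoCapture (var [ x ↦ var w ]) φ
  noCapture {v} v∈ z∈ z∈v with v ≟ x
  ... | yes _ = ⊥-elim (w∉ (∈-++⁺ʳ (fv φ) (≡.subst (_∈ bv φ) (∈-singleton z∈v) z∈)))
  ... | no  _ = sym (∈-singleton z∈v)

  inverse : (var [ w ↦ var x ]) LeftInverseOf (var [ x ↦ var w ]) On fv φ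
  inverse {v} v∈ with v ≟ x
  ... | yes refl = update-same var w (var x)
  ... | no  _    = update-other var (var x) λ { refl → w∉ (∈-++⁺ˡ v∈) }

private
  binder-[] : ∀ (φ : Formula S) → y ∉ fvTerm t → binder (var [ x ↦ t ]) y φ ≡ y
  binder-[] {y = y} {t = t} {x = x} φ y∉t = binder-unchanged {σ = var [ x ↦ t ]} φ avoids
    where
    avoids : ∀ {v} → v ∈ fv φ → v ≢ y → y ∉ fvTerm ((var [ x ↦ t ]) v)
    avoids {v} _ v≢y y∈ with v ≟ x
    ... | yes _ = y∉t y∈
    ... | no  _ = v≢y (sym (∈-singleton y∈))

  update-redundant : y ≢ x → ((var [ x ↦ t ]) [ y ↦ var y ]) ≗ (var [ x ↦ t ])
  update-redundant {y = y} {t = t} y≢x v with v ≟ y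
  ... | yes refl = sym (update-other var t y≢x)
  ... | no  _    = refl

[]-∃ : ∀ (φ : Formula S) → y ≢ x → y ∉ fvTerm t → (∃′ y φ) [ t / x ] ≡ ∃′ y (φ [ t / x ])
[]-∃ {x = x} {t = t} φ y≢x y∉t rewrite binder-[] {t = t} {x = x} φ y∉t =
  cong (∃′ _) (subst-cong (update-redundant y≢x) φ)

[]-∀ : ∀ (φ : Formula S) → y ≢ x → y ∉ fvTerm t → (∀′ y φ) [ t / x ] ≡ ∀′ y (φ [ t / x ])
[]-∀ {x = x} {t = t} φ y≢x y∉t rewrite binder-[] {t = t} {x = x} φ y∉t =
  cong (∀′ _) (subst-cong (update-redundant y≢x) φ)

-- α-equivalence

shift : Term S → Term S
shift = substTerm (var ∘ suc)

-- Variables of terms in the range of the substitutions e and e′ below are read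
-- as de Bruijn indices.
under : Var → Subst S → Subst S
under x e = (shift ∘ e) [ x ↦ var 0 ]

lift : Subst S → Subst S
lift θ zero    = var 0
lift θ (suc v) = shift (θ v)

infix 3 _∙_≋_∙_

-- φ and ψ have the same de Bruijn representation when their free variables are
-- interpreted by e and e′.
data _∙_≋_∙_ {S : Signature} : Formula S → Subst S → Formula S → Subst S → Set where
  rel : ∀ {R ts ss e e′} → substTerms e ts ≡ substTerms e′ ss → rel R ts ∙ e ≋ rel R ss ∙ e′
  ⊥   : ∀ {e e′} → ⊥ ∙ e ≋ ⊥ ∙ e′
  _∧_ : ∀ {φ φ′ ψ ψ′ e e′} → φ ∙ e ≋ ψ ∙ e′ → φ′ ∙ e ≋ ψ′ ∙ e′ → φ ∧ φ′ ∙ e ≋ ψ ∧ ψ′ ∙ e′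
  _∨_ : ∀ {φ φ′ ψ ψ′ e e′} → φ ∙ e ≋ ψ ∙ e′ → φ′ ∙ e ≋ ψ′ ∙ e′ → φ ∨ φ′ ∙ e ≋ ψ ∨ ψ′ ∙ e′
  _⇒_ : ∀ {φ φ′ ψ ψ′ e e′} → φ ∙ e ≋ ψ ∙ e′ → φ′ ∙ e ≋ ψ′ ∙ e′ → φ ⇒ φ′ ∙ e ≋ ψ ⇒ ψ′ ∙ e′
  ∃′  : ∀ {x y φ ψ e e′} → φ ∙ under x e ≋ ψ ∙ under y e′ → ∃′ x φ ∙ e ≋ ∃′ y ψ ∙ e′
  ∀′  : ∀ {x y φ ψ e e′} → φ ∙ under x e ≋ ψ ∙ under y e′ → ∀′ x φ ∙ e ≋ ∀′ y ψ ∙ e′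

≋-refl : (φ : Formula S) → φ ∙ e ≋ φ ∙ e
≋-refl (rel R ts) = rel refl
≋-refl ⊥          = ⊥
≋-refl (φ ∧ ψ)    = ≋-refl φ ∧ ≋-refl ψ
≋-refl (φ ∨ ψ)    = ≋-refl φ ∨ ≋-refl ψ
≋-refl (φ ⇒ ψ)    = ≋-refl φ ⇒ ≋-refl ψ
≋-refl (∃′ x φ)   = ∃′ (≋-refl φ)
≋-refl (∀′ x φ)   = ∀′ (≋-refl φ)

private
  under-fresh : ∀ (s : Term S) → x ∉ fvTerm s → substTerm (under x f) s ≡ shift (substTerm f s)
  under-fresh {f = f} s x∉ = substTerm-fuse s λ v∈ →
    update-other (shift ∘ f) (var 0) λ { refl → x∉ v∈ }

  -- The name of the binder after substitution is fresh for the terms put in for the other free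
  -- variables, so reading it as index 0 merely shifts those terms.
  under-square : ∀ (f σ θ e : Subst S) (φ : Formula S) →
    (∀ {v} → v ∈ remove x (fv φ) → substTerm f (σ v) ≡ substTerm θ (e v)) →
    ∀ {v} → v ∈ fv φ →
    substTerm (under (binder σ x φ) f) ((σ [ x ↦ var (binder σ x φ) ]) v) ≡
    substTerm (lift θ) (under x e v)
  under-square {x = x} f σ θ e φ h {v} v∈ with v ≟ x
  ... | yes _   = update-same (shift ∘ f) (binder σ x φ) (var 0)
  ... | no  v≢x = trans (under-fresh (σ v) (binder-avoids σ x φ v∈ v≢x))
    (trans (cong shift (h (∈-remove⁺ v≢x v∈))) (substTerm-square (e v) (λ _ → refl)))

-- The two substitutions may differ, as long as both amount to the same `θ` on de Bruijn indices.
-- This generality covers renaming a bound variable and opening two differently named bodies by one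
-- term.
≋-subst : φ ∙ e ≋ ψ ∙ e′ → ∀ (θ : Subst S) →
          (∀ {v} → v ∈ fv φ → substTerm f (σ v) ≡ substTerm θ (e v)) →
          (∀ {v} → v ∈ fv ψ → substTerm f′ (τ v) ≡ substTerm θ (e′ v)) →
          subst σ φ ∙ f ≋ subst τ ψ ∙ f′
≋-subst (rel {ts = ts} {ss = ss} eq) θ h h′ = rel
  (trans (substTerms-square ts h) (trans (cong (substTerms θ) eq) (sym (substTerms-square ss h′))))
≋-subst ⊥ θ h h′ = ⊥
≋-subst (_∧_ {φ = φ} {ψ = ψ} α β) θ h h′ =
  ≋-subst α θ (h ∘ ∈-++⁺ˡ) (h′ ∘ ∈-++⁺ˡ) ∧
  ≋-subst β θ (h ∘ ∈-++⁺ʳ (fv φ)) (h′ ∘ ∈-++⁺ʳ (fv ψ))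
≋-subst (_∨_ {φ = φ} {ψ = ψ} α β) θ h h′ =
  ≋-subst α θ (h ∘ ∈-++⁺ˡ) (h′ ∘ ∈-++⁺ˡ) ∨
  ≋-subst β θ (h ∘ ∈-++⁺ʳ (fv φ)) (h′ ∘ ∈-++⁺ʳ (fv ψ))
≋-subst (_⇒_ {φ = φ} {ψ = ψ} α β) θ h h′ =
  ≋-subst α θ (h ∘ ∈-++⁺ˡ) (h′ ∘ ∈-++⁺ˡ) ⇒
  ≋-subst β θ (h ∘ ∈-++⁺ʳ (fv φ)) (h′ ∘ ∈-++⁺ʳ (fv ψ))
≋-subst {f = f} {σ = σ} {f′ = f′} {τ = τ} (∃′ {φ = φ} {ψ} {e} {e′} α) θ h h′ =
  ∃′ (≋-subst α (lift θ) (under-square f σ θ e φ h) (under-square f′ τ θ e′ ψ h′))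
≋-subst {f = f} {σ = σ} {f′ = f′} {τ = τ} (∀′ {φ = φ} {ψ} {e} {e′} α) θ h h′ =
  ∀′ (≋-subst α (lift θ) (under-square f σ θ e φ h) (under-square f′ τ θ e′ ψ h′))

infix 3 _≋_

_≋_ : Formula S → Formula S → Set
φ ≋ ψ = φ ∙ var ≋ ψ ∙ var

≋-subst-closed : ∀ (σ : Subst S) → φ ≋ ψ → subst σ φ ≋ subst σ ψ
≋-subst-closed σ α = ≋-subst α σ (λ _ → substTerm-var _) (λ _ → substTerm-var _)

≋-rename-body : ∀ (φ : Formula S) → w ∉ fv φ →
                φ ∙ under x var ≋ φ [ var w / x ] ∙ under w var
≋-rename-body {w = w} {x = x} φ w∉ =
  -- `≋-subst` compares two substituted formulas, so the left `φ` is first taken as its image under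
  -- the identity.
  ≡.subst (λ φ′ → φ′ ∙ under x var ≋ φ [ var w / x ] ∙ under w var) (subst-id φ (λ _ → refl))
    (≋-subst (≋-refl {e = under x var} φ) var (λ _ → sym (substTerm-var _)) renamed)
  where
  renamed : ∀ {v} → v ∈ fv φ →
            substTerm (under w var) ((var [ x ↦ var w ]) v) ≡ substTerm var (under x var v)
  renamed {v} v∈ with v ≟ x
  ... | yes _ = update-same (shift ∘ var) w (var 0)
  ... | no  _ = update-other (shift ∘ var) (var 0) λ { refl → w∉ v∈ }

≋-instantiate : φ ∙ under x var ≋ ψ ∙ under y var → φ [ t / x ] ≋ ψ [ t / y ]
≋-instantiate {S} {x = x} {y = y} {t = t} α =
  ≋-subst α instantiate (λ {v} _ → eq x v) (λ {v} _ → eq y v)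
  where
  -- De Bruijn opening: index 0 becomes `t`, and the higher indices drop by one.
  instantiate : Subst S
  instantiate zero    = t
  instantiate (suc v) = var v

  eq : ∀ x v → substTerm var ((var [ x ↦ t ]) v) ≡ substTerm instantiate (under x var v)
  eq x v with v ≟ x
  ... | yes _ = substTerm-var t
  ... | no  _ = refl

-- The measure for the simultaneous induction below. It is invariant under substitution and
-- α-equivalence, so it admits recursion on a renamed body, which is not structurally smaller.
depth : Formula S → ℕ
depth (rel R ts) = 0
depth ⊥          = 0
depth (φ ∧ ψ)    = suc (depth φ ⊔ depth ψ)
depth (φ ∨ ψ)    = suc (depth φ ⊔ depth ψ)
depth (φ ⇒ ψ)    = suc (depth φ ⊔ depth ψ)
depth (∃′ x φ)   = suc (depth φ)
depth (∀′ x φ)   = suc (depth φ)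

depth-subst : ∀ (σ : Subst S) φ → depth (subst σ φ) ≡ depth φ
depth-subst σ (rel R ts) = refl
depth-subst σ ⊥          = refl
depth-subst σ (φ ∧ ψ)    = cong suc (cong₂ _⊔_ (depth-subst σ φ) (depth-subst σ ψ))
depth-subst σ (φ ∨ ψ)    = cong suc (cong₂ _⊔_ (depth-subst σ φ) (depth-subst σ ψ))
depth-subst σ (φ ⇒ ψ)    = cong suc (cong₂ _⊔_ (depth-subst σ φ) (depth-subst σ ψ))
depth-subst σ (∃′ x φ)   = cong suc (depth-subst _ φ)
depth-subst σ (∀′ x φ)   = cong suc (depth-subst _ φ)

depth-≋ : φ ∙ e ≋ ψ ∙ e′ → depth φ ≡ depth ψ
depth-≋ (rel _) = refl
depth-≋ ⊥       = refl
depth-≋ (α ∧ β) = cong suc (cong₂ _⊔_ (depth-≋ α) (depth-≋ β))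
depth-≋ (α ∨ β) = cong suc (cong₂ _⊔_ (depth-≋ α) (depth-≋ β))
depth-≋ (α ⇒ β) = cong suc (cong₂ _⊔_ (depth-≋ α) (depth-≋ β))
depth-≋ (∃′ α)  = cong suc (depth-≋ α)
depth-≋ (∀′ α)  = cong suc (depth-≋ α)

-- Derivations and provable equivalence

weaken₁ : Γ ⊢[ L ] φ → ψ ∷ Γ ⊢[ L ] φ
weaken₁ = weaken there

assume₀ : φ ∷ Γ ⊢[ L ] φ
assume₀ = assume (here refl)

cut : All (Γ ⊢[ L ]_) Δ → Δ ⊢[ L ] φ → Γ ⊢[ L ] φ
cut []       d = weaken (λ ()) d
cut (p ∷ ps) d = ⇒E (cut ps (⇒I d)) p

∃I-self : Γ ⊢[ L ] φ → Γ ⊢[ L ] ∃′ x φ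
∃I-self {Γ = Γ} {L = L} {φ = φ} {x = x} d =
  ∃I (var x) (≡.subst (Γ ⊢[ L ]_) (sym ([var-self] φ x)) d)

∀E-self : Γ ⊢[ L ] ∀′ x φ → Γ ⊢[ L ] φ
∀E-self {Γ = Γ} {L = L} {x = x} {φ = φ} d =
  ≡.subst (Γ ⊢[ L ]_) ([var-self] φ x) (∀E (var x) d)

⇔I : φ ∷ [] ⊢[ L ] ψ → ψ ∷ [] ⊢[ L ] φ → [] ⊢[ L ] φ ⇔ ψ
⇔I d d′ = ∧I (⇒I d) (⇒I d′)

⇔E₁ : [] ⊢[ L ] φ ⇔ ψ → Γ ⊢[ L ] φ → Γ ⊢[ L ] ψ
⇔E₁ p = ⇒E (weaken (λ ()) (∧E₁ p))

⇔E₂ : [] ⊢[ L ] φ ⇔ ψ → Γ ⊢[ L ] ψ → Γ ⊢[ L ] φ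
⇔E₂ p = ⇒E (weaken (λ ()) (∧E₂ p))

⇔-refl : [] ⊢[ L ] φ ⇔ φ
⇔-refl = ⇔I assume₀ assume₀

⇔-reflexive : φ ≡ ψ → [] ⊢[ L ] φ ⇔ ψ
⇔-reflexive refl = ⇔-refl

⇔-sym : [] ⊢[ L ] φ ⇔ ψ → [] ⊢[ L ] ψ ⇔ φ
⇔-sym p = ∧I (∧E₂ p) (∧E₁ p)

infixr 4 _⟨⇔⟩_

_⟨⇔⟩_ : [] ⊢[ L ] φ ⇔ ψ → [] ⊢[ L ] ψ ⇔ χ → [] ⊢[ L ] φ ⇔ χ
p ⟨⇔⟩ q = ⇔I (⇔E₁ q (⇔E₁ p assume₀)) (⇔E₂ p (⇔E₂ q assume₀))

∧-cong : [] ⊢[ L ] φ ⇔ φ′ → [] ⊢[ L ] ψ ⇔ ψ′ → [] ⊢[ L ] φ ∧ ψ ⇔ φ′ ∧ ψ′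
∧-cong p q = ⇔I (∧I (⇔E₁ p (∧E₁ assume₀)) (⇔E₁ q (∧E₂ assume₀)))
                (∧I (⇔E₂ p (∧E₁ assume₀)) (⇔E₂ q (∧E₂ assume₀)))

∨-cong : [] ⊢[ L ] φ ⇔ φ′ → [] ⊢[ L ] ψ ⇔ ψ′ → [] ⊢[ L ] φ ∨ ψ ⇔ φ′ ∨ ψ′
∨-cong p q = ⇔I (∨E assume₀ (∨I₁ (⇔E₁ p assume₀)) (∨I₂ (⇔E₁ q assume₀)))
                (∨E assume₀ (∨I₁ (⇔E₂ p assume₀)) (∨I₂ (⇔E₂ q assume₀)))

⇒-cong : [] ⊢[ L ] φ ⇔ φ′ → [] ⊢[ L ] ψ ⇔ ψ′ → [] ⊢[ L ] (φ ⇒ ψ) ⇔ (φ′ ⇒ ψ′)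
⇒-cong p q = ⇔I (⇒I (⇔E₁ q (⇒E (weaken₁ assume₀) (⇔E₂ p assume₀))))
                (⇒I (⇔E₂ q (⇒E (weaken₁ assume₀) (⇔E₁ p assume₀))))

∃-cong : [] ⊢[ L ] φ ⇔ ψ → [] ⊢[ L ] ∃′ x φ ⇔ ∃′ x ψ
∃-cong {φ = φ} {ψ = ψ} p = ⇔I
  (∃E (∉-remove (fv φ) ∷ []) (∉-remove (fv ψ)) assume₀ (∃I-self (⇔E₁ p assume₀)))
  (∃E (∉-remove (fv ψ) ∷ []) (∉-remove (fv φ)) assume₀ (∃I-self (⇔E₂ p assume₀)))

∀-cong : [] ⊢[ L ] φ ⇔ ψ → [] ⊢[ L ] ∀′ x φ ⇔ ∀′ x ψ
∀-cong {φ = φ} {ψ = ψ} p = ⇔I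
  (∀I (∉-remove (fv φ) ∷ []) (⇔E₁ p (∀E-self assume₀)))
  (∀I (∉-remove (fv ψ) ∷ []) (⇔E₂ p (∀E-self assume₀)))

-- An equivalence proved without assumptions can be generalised over `x` and then instantiated.
[]-cong : ∀ t → [] ⊢[ L ] φ ⇔ ψ → [] ⊢[ L ] φ [ t / x ] ⇔ ψ [ t / x ]
[]-cong t p = ∀E t (∀I [] p)

private
  ∉-renamed : ∀ φ → w ∉ x ∷ vars φ → x ∉ fv {S} (φ [ var w / x ])
  ∉-renamed {w = w} φ w∉ =
    ∉-fv-[] φ (var w) (λ x∈ → w∉ (here (sym (∈-singleton x∈))))

-- Forwards the witness is `var x`, because renaming back restores `φ` literally; backwards it is
-- `var w`. Since `w` differs from `x`, the renamed body lacks `x`, which gives the forward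
-- eigenvariable condition.
∃-rename : w ∉ x ∷ vars φ → [] ⊢[ L ] ∃′ x φ ⇔ ∃′ w (φ [ var w / x ])
∃-rename {w} {x} {φ = φ} {L} w∉ = ⇔I
  (∃E (∉-remove (fv φ) ∷ []) (∉-remove-mono (fv φ₁) (∉-renamed φ w∉)) assume₀
    (∃I (var x) (≡.subst (_ ⊢[ L ]_) (sym (rename-inverse φ (w∉ ∘ there))) assume₀)))
  (∃E (∉-remove (fv φ₁) ∷ []) (∉-remove-mono (fv φ) (w∉ ∘ there ∘ ∈-++⁺ˡ)) assume₀
    (∃I (var w) assume₀))
  where
  φ₁ = φ [ var w / x ]

∀-rename : w ∉ x ∷ vars φ → [] ⊢[ L ] ∀′ x φ ⇔ ∀′ w (φ [ var w / x ])
∀-rename {w} {x} {φ = φ} {L} w∉ = ⇔I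
  (∀I (∉-remove-mono (fv φ) (w∉ ∘ there ∘ ∈-++⁺ˡ) ∷ []) (∀E (var w) assume₀))
  (∀I (∉-remove-mono (fv (φ [ var w / x ])) (∉-renamed φ w∉) ∷ [])
    (≡.subst (∀′ w (φ [ var w / x ]) ∷ [] ⊢[ L ]_) (rename-inverse φ (w∉ ∘ there))
      (∀E (var x) assume₀)))

-- Eigenvariable conditions up to provable equivalence

Independent : Logic → Var → Formula S → Set
Independent L x φ = ∃[ φ′ ] (x ∉ fv φ′ × [] ⊢[ L ] φ ⇔ φ′)

∉⇒independent : x ∉ fv φ → Independent L x φ
∉⇒independent x∉ = _ , x∉ , ⇔-refl

-- Substituting `suc x`, a variable other than `x`, removes `x`, and by hypothesis the result is
-- still equivalent to `φ`.
fixed⇒independent : (∀ t → [] ⊢[ L ] φ [ t / x ] ⇔ φ) → Independent L x φ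
fixed⇒independent {φ = φ} {x = x} h =
  φ [ var (suc x) / x ] , ∉-fv-[] φ _ (λ x∈ → 1+n≢n (sym (∈-singleton x∈))) , ⇔-sym (h _)

-- `Γ` is exchanged for an interderivable context that literally lacks `x`, so that the original
-- quantifier rules apply there; `cut` translates in both directions.
replace-independent : All (Independent L x) Γ →
  ∃[ Γ′ ] (All (λ γ → x ∉ fv γ) Γ′ × All (Γ ⊢[ L ]_) Γ′ × All (Γ′ ⊢[ L ]_) Γ)
replace-independent [] = [] , [] , [] , []
replace-independent ((φ′ , x∉ , p) ∷ ps) =
  let Γ′ , x∉Γ′ , Γ⊢Γ′ , Γ′⊢Γ = replace-independent ps in
  φ′ ∷ Γ′ , x∉ ∷ x∉Γ′ , ⇔E₁ p assume₀ ∷ All.map weaken₁ Γ⊢Γ′ ,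
  ⇔E₂ p assume₀ ∷ All.map weaken₁ Γ′⊢Γ

∀I-independent : All (Independent L x) Γ → Γ ⊢[ L ] φ → Γ ⊢[ L ] ∀′ x φ
∀I-independent ind d =
  let Γ′ , x∉Γ′ , Γ⊢Γ′ , Γ′⊢Γ = replace-independent ind in
  cut Γ⊢Γ′ (∀I x∉Γ′ (cut Γ′⊢Γ d))

∃E-independent : All (Independent L x) Γ → Independent L x ψ →
                 Γ ⊢[ L ] ∃′ x φ → φ ∷ Γ ⊢[ L ] ψ → Γ ⊢[ L ] ψ
∃E-independent ind (ψ′ , x∉ψ′ , p) d d′ =
  let Γ′ , x∉Γ′ , Γ⊢Γ′ , Γ′⊢Γ = replace-independent ind in
  ⇔E₂ p (cut Γ⊢Γ′ (∃E x∉Γ′ x∉ψ′ (cut Γ′⊢Γ d)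
                     (⇔E₁ p (cut (assume₀ ∷ All.map weaken₁ Γ′⊢Γ) d′))))

-- Laws of a nucleus

module _ {S : Signature} {L : Logic} {j : Formula S → Formula S} (nucleus : IsNucleus L j) where
  open IsNucleus nucleus

  private variable
    A B : Formula S
    Γ′ : List (Formula S)

  jI : Γ′ ⊢[ L ] A → Γ′ ⊢[ L ] j A
  jI = ⇒E (weaken (λ ()) (unit _))

  -- By `bind`, towards a goal of the form `j B` a derivation of `j A` is as good as an assumption
  -- `A`.
  jE : Γ′ ⊢[ L ] j A → A ∷ Γ′ ⊢[ L ] j B → Γ′ ⊢[ L ] j B
  jE d d′ = ⇒E (⇒E (weaken (λ ()) (bind _ _)) (⇒I d′)) d

  j-mono : A ∷ [] ⊢[ L ] B → j A ∷ [] ⊢[ L ] j B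
  j-mono d = jE assume₀ (jI (weaken (λ { (here p) → here p }) d))

  j-cong : [] ⊢[ L ] A ⇔ B → [] ⊢[ L ] j A ⇔ j B
  j-cong p = ⇔I (j-mono (⇔E₁ p assume₀)) (j-mono (⇔E₂ p assume₀))

  -- For the equivalent `A′` without `x`, `commutes` makes `(j A′) [ t / x ]` equivalent to
  -- `j (A′ [ t / x ])`, which is literally `j A′`.
  j-independent : Independent L x A → Independent L x (j A)
  j-independent {A = A} (A′ , x∉ , p) =
    let B , x∉B , q = fixed⇒independent λ t →
          commutes A′ _ t ⟨⇔⟩ ⇔-reflexive (cong j ([]-not-free A′ t x∉))
    in B , x∉B , j-cong p ⟨⇔⟩ q

  j-∨ : [] ⊢[ L ] j (j A ∨ j B) ⇔ j (A ∨ B)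
  j-∨ = ⇔I (jE assume₀ (∨E assume₀ (jE assume₀ (jI (∨I₁ assume₀))) (jE assume₀ (jI (∨I₂ assume₀)))))
           (jE assume₀ (jI (∨E assume₀ (∨I₁ (jI assume₀)) (∨I₂ (jI assume₀)))))

  j-⇒ : [] ⊢[ L ] (j A ⇒ j B) ⇔ j (A ⇒ j B)
  j-⇒ = ⇔I (jI (⇒I (⇒E (weaken₁ assume₀) (jI assume₀))))
           (⇒I (jE (weaken₁ assume₀) (jE (weaken₁ assume₀) (⇒E (weaken₁ assume₀) assume₀))))

  j-∃ : [] ⊢[ L ] j (∃′ x (j A)) ⇔ j (∃′ x A)
  j-∃ {A = A} = ⇔I
    -- Both the open assumption `j (∃′ x (j A))` and the goal `j (∃′ x A)` may contain `x` free,
    -- since `j` can introduce it.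
    (jE assume₀ (∃E-independent
      (∉⇒independent (∉-remove (fv (j A))) ∷
        j-independent (∉⇒independent (∉-remove (fv (j A)))) ∷ [])
      (j-independent (∉⇒independent (∉-remove (fv A))))
      assume₀ (jE assume₀ (jI (∃I-self assume₀)))))
    (j-mono (∃E (∉-remove (fv A) ∷ []) (∉-remove (fv (j A))) assume₀ (∃I-self (jI assume₀))))

  j-∀ : [] ⊢[ L ] ∀′ x (j A) ⇔ j (∀′ x (j A))
  j-∀ {A = A} = ⇔I (jI assume₀)
    (∀I-independent (j-independent (∉⇒independent (∉-remove (fv (j A)))) ∷ [])
      (jE assume₀ (∀E-self assume₀)))

  -- Equivalence of the two translations

  gödelGentzen⇔kuroda : ∀ φ → [] ⊢[ L ] gödelGentzen j φ ⇔ kuroda j φ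
  gödelGentzen⇔kuroda (rel R ts) = ⇔-refl
  gödelGentzen⇔kuroda ⊥          = ⇔-refl
  gödelGentzen⇔kuroda (φ ∧ ψ)    =
    ∧-cong (gödelGentzen⇔kuroda φ) (gödelGentzen⇔kuroda ψ) ⟨⇔⟩ ⇔-sym (conj _ _)
  gödelGentzen⇔kuroda (φ ∨ ψ)    =
    j-cong (∨-cong (gödelGentzen⇔kuroda φ) (gödelGentzen⇔kuroda ψ)) ⟨⇔⟩ j-∨
  gödelGentzen⇔kuroda (φ ⇒ ψ)    =
    ⇒-cong (gödelGentzen⇔kuroda φ) (gödelGentzen⇔kuroda ψ) ⟨⇔⟩ j-⇒
  gödelGentzen⇔kuroda (∃′ x φ)   = j-cong (∃-cong (gödelGentzen⇔kuroda φ)) ⟨⇔⟩ j-∃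
  gödelGentzen⇔kuroda (∀′ x φ)   = ∀-cong (gödelGentzen⇔kuroda φ) ⟨⇔⟩ j-∀

  -- Invariance of the Kuroda translation under α-equivalence and substitution

  mutual
    -- For quantifiers, both translated bodies are renamed to one new variable, `J-[]` moves the
    -- renaming inside `J`, and the opened bodies are α-equivalent with the depth of the original
    -- ones.
    J-≋ : ∀ n → depth φ ≤ n → φ ≋ ψ → [] ⊢[ L ] J j φ ⇔ J j ψ
    J-≋ n _ (rel {R} {ts} {ss} eq) = ⇔-reflexive (cong (rel R)
      (trans (sym (substTerms-id ts (λ _ → refl))) (trans eq (substTerms-id ss (λ _ → refl)))))
    J-≋ n _ ⊥ = ⇔-refl
    J-≋ (suc n) (s≤s d) (α ∧ β) =
      ∧-cong (J-≋ n (m⊔n≤o⇒m≤o _ _ d) α) (J-≋ n (m⊔n≤o⇒n≤o _ _ d) β)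
    J-≋ (suc n) (s≤s d) (α ∨ β) =
      ∨-cong (J-≋ n (m⊔n≤o⇒m≤o _ _ d) α) (J-≋ n (m⊔n≤o⇒n≤o _ _ d) β)
    J-≋ (suc n) (s≤s d) (α ⇒ β) =
      ⇒-cong (J-≋ n (m⊔n≤o⇒m≤o _ _ d) α) (j-cong (J-≋ n (m⊔n≤o⇒n≤o _ _ d) β))
    J-≋ (suc n) (s≤s d) (∃′ {x} {y} {φ} {ψ} α) =
      ∃-rename (new∉ ∘ ∈-++⁺ˡ)
      ⟨⇔⟩ ∃-cong (J-[] n φ d x (var new)
            ⟨⇔⟩ J-≋ n (depth-[] φ d) (≋-instantiate α)
            ⟨⇔⟩ ⇔-sym (J-[] n ψ (≡.subst (_≤ n) (depth-≋ α) d) y (var new)))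
      ⟨⇔⟩ ⇔-sym (∃-rename (new∉ ∘ ∈-++⁺ʳ (x ∷ vars (J j φ))))
      where
      -- The renaming acts on the translated bodies, which may contain variables that `φ` and `ψ`
      -- lack.
      avoid = (x ∷ vars (J j φ)) ++ (y ∷ vars (J j ψ))
      new : Var
      new = suc (max 0 avoid)
      new∉ = suc-max∉ avoid
    J-≋ (suc n) (s≤s d) (∀′ {x} {y} {φ} {ψ} α) =
      ∀-rename (new∉ ∘ ∈-++⁺ˡ)
      ⟨⇔⟩ ∀-cong (kuroda-[] n φ d x (var new)
            ⟨⇔⟩ j-cong (J-≋ n (depth-[] φ d) (≋-instantiate α))
            ⟨⇔⟩ ⇔-sym (kuroda-[] n ψ (≡.subst (_≤ n) (depth-≋ α) d) y (var new)))
      ⟨⇔⟩ ⇔-sym (∀-rename (new∉ ∘ ∈-++⁺ʳ (x ∷ vars (kuroda j φ))))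
      where
      avoid = (x ∷ vars (kuroda j φ)) ++ (y ∷ vars (kuroda j ψ))
      new : Var
      new = suc (max 0 avoid)
      new∉ = suc-max∉ avoid

    depth-[] : ∀ φ {n} → depth φ ≤ n → depth (φ [ t / x ]) ≤ n
    depth-[] φ = ≡.subst (_≤ _) (sym (depth-subst _ φ))

    kuroda-[] : ∀ n φ → depth φ ≤ n → ∀ x t →
                [] ⊢[ L ] (kuroda j φ) [ t / x ] ⇔ kuroda j (φ [ t / x ])
    kuroda-[] n φ d x t = commutes (J j φ) x t ⟨⇔⟩ j-cong (J-[] n φ d x t)

    -- For quantifiers, the two sides may choose different binder names, since `J j φ` and `φ` may
    -- differ in free variables. Renaming the binder to a sufficiently new variable first lets the
    -- substitution pass it literally; the renaming inside `J` is then undone by `J-≋`.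
    J-[] : ∀ n φ → depth φ ≤ n → ∀ x t → [] ⊢[ L ] (J j φ) [ t / x ] ⇔ J j (φ [ t / x ])
    J-[] n (rel R ts) _ x t = ⇔-refl
    J-[] n ⊥ _ x t = ⇔-refl
    J-[] (suc n) (φ ∧ ψ) (s≤s d) x t =
      ∧-cong (J-[] n φ (m⊔n≤o⇒m≤o _ _ d) x t) (J-[] n ψ (m⊔n≤o⇒n≤o _ _ d) x t)
    J-[] (suc n) (φ ∨ ψ) (s≤s d) x t =
      ∨-cong (J-[] n φ (m⊔n≤o⇒m≤o _ _ d) x t) (J-[] n ψ (m⊔n≤o⇒n≤o _ _ d) x t)
    J-[] (suc n) (φ ⇒ ψ) (s≤s d) x t =
      ⇒-cong (J-[] n φ (m⊔n≤o⇒m≤o _ _ d) x t) (kuroda-[] n ψ (m⊔n≤o⇒n≤o _ _ d) x t)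
    J-[] (suc n) (∃′ y φ) (s≤s d) x t =
      []-cong t (∃-rename (new∉ ∘ ∈-++⁺ˡ))
      ⟨⇔⟩ ⇔-reflexive ([]-∃ (J j φ [ var new / y ]) new≢x new∉t)
      ⟨⇔⟩ ∃-cong ([]-cong t (J-[] n φ d y (var new))
            ⟨⇔⟩ J-[] n (φ [ var new / y ]) (depth-[] φ d) x t)
      ⟨⇔⟩ ⇔-reflexive (cong (J j) (sym ([]-∃ (φ [ var new / y ]) new≢x new∉t)))
      -- The bound does not decrease in this call, but `J-≋` at `suc n` returns to `J-[]` only at
      -- `n`, so the recursion terminates.
      ⟨⇔⟩ ⇔-sym (J-≋ (suc n) (depth-[] (∃′ y φ) (s≤s d))
            (≋-subst-closed _ (∃′ (≋-rename-body φ new∉φ))))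
      where
      avoid₁ = y ∷ vars (J j φ)
      avoid₂ = fv φ ++ x ∷ fvTerm t
      new : Var
      new = suc (max 0 (avoid₁ ++ avoid₂))
      new∉ = suc-max∉ (avoid₁ ++ avoid₂)
      new∉φ : new ∉ fv φ
      new∉φ = new∉ ∘ ∈-++⁺ʳ avoid₁ ∘ ∈-++⁺ˡ
      new≢x : new ≢ x
      new≢x = new∉ ∘ ∈-++⁺ʳ avoid₁ ∘ ∈-++⁺ʳ (fv φ) ∘ here
      new∉t : new ∉ fvTerm t
      new∉t = new∉ ∘ ∈-++⁺ʳ avoid₁ ∘ ∈-++⁺ʳ (fv φ) ∘ there
    J-[] (suc n) (∀′ y φ) (s≤s d) x t =
      []-cong t (∀-rename (new∉ ∘ ∈-++⁺ˡ))
      ⟨⇔⟩ ⇔-reflexive ([]-∀ (kuroda j φ [ var new / y ]) new≢x new∉t)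
      ⟨⇔⟩ ∀-cong ([]-cong t (kuroda-[] n φ d y (var new))
            ⟨⇔⟩ kuroda-[] n (φ [ var new / y ]) (depth-[] φ d) x t)
      ⟨⇔⟩ ⇔-reflexive (cong (J j) (sym ([]-∀ (φ [ var new / y ]) new≢x new∉t)))
      ⟨⇔⟩ ⇔-sym (J-≋ (suc n) (depth-[] (∀′ y φ) (s≤s d))
            (≋-subst-closed _ (∀′ (≋-rename-body φ new∉φ))))
      where
      avoid₁ = y ∷ vars (kuroda j φ)
      avoid₂ = fv φ ++ x ∷ fvTerm t
      new : Var
      new = suc (max 0 (avoid₁ ++ avoid₂))
      new∉ = suc-max∉ (avoid₁ ++ avoid₂)
      new∉φ : new ∉ fv φ
      new∉φ = new∉ ∘ ∈-++⁺ʳ avoid₁ ∘ ∈-++⁺ˡ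
      new≢x : new ≢ x
      new≢x = new∉ ∘ ∈-++⁺ʳ avoid₁ ∘ ∈-++⁺ʳ (fv φ) ∘ here
      new∉t : new ∉ fvTerm t
      new∉t = new∉ ∘ ∈-++⁺ʳ avoid₁ ∘ ∈-++⁺ʳ (fv φ) ∘ there

  J-commutes : ∀ φ x t → [] ⊢[ L ] (J j φ) [ t / x ] ⇔ J j (φ [ t / x ])
  J-commutes φ = J-[] (depth φ) φ ≤-refl

  -- Soundness of the Kuroda translation

  J-independent : ∀ φ → x ∉ fv φ → Independent L x (J j φ)
  J-independent φ x∉ = fixed⇒independent λ t →
    J-commutes φ _ t ⟨⇔⟩ ⇔-reflexive (cong (J j) ([]-not-free φ t x∉))

  J-independents : ∀ {Γ} → All (λ γ → x ∉ fv γ) Γ → All (Independent L x) (map (J j) Γ)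
  J-independents = All-map⁺ ∘ All.map (J-independent _)

  -- Each translated axiom follows from an instance of the same axiom; for excluded middle, `unit`
  -- turns a refutation of the translated formula into an implication with conclusion `j ⊥`.
  kuroda-axiom : Axiom L A → [] ⊢[ L ] kuroda j A
  kuroda-axiom exFalsoᴵ = jI (⇒I (⇒E (axm exFalsoᴵ) assume₀))
  kuroda-axiom exFalsoᶜ = jI (⇒I (⇒E (axm exFalsoᶜ) assume₀))
  kuroda-axiom lem      = jI (∨E (axm lem) (∨I₁ assume₀)
    (∨I₂ (⇒I (jI (⇒E (weaken₁ assume₀) assume₀)))))

  -- Every translated conclusion has the form `j B`, so `jE` strips `j` from the major premises of
  -- `∨E` and `∃E` before the original rule is applied.
  kuroda-sound : ∀ {Γ} → Γ ⊢[ L ] A → map (J j) Γ ⊢[ L ] kuroda j A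
  kuroda-sound (assume p)   = jI (assume (∈-map⁺ (J j) p))
  kuroda-sound (axm a)      = weaken (λ ()) (kuroda-axiom a)
  kuroda-sound (weaken s d) = weaken (map⁺ (J j) s) (kuroda-sound d)
  kuroda-sound (∧I d d′)    = ⇔E₂ (conj _ _) (∧I (kuroda-sound d) (kuroda-sound d′))
  kuroda-sound (∧E₁ d)      = ∧E₁ (⇔E₁ (conj _ _) (kuroda-sound d))
  kuroda-sound (∧E₂ d)      = ∧E₂ (⇔E₁ (conj _ _) (kuroda-sound d))
  kuroda-sound (∨I₁ d)      = jE (kuroda-sound d) (jI (∨I₁ assume₀))
  kuroda-sound (∨I₂ d)      = jE (kuroda-sound d) (jI (∨I₂ assume₀))
  kuroda-sound (∨E d d₁ d₂) = jE (kuroda-sound d) (∨E assume₀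
    (weaken (∷⁺ʳ _ there) (kuroda-sound d₁))
    (weaken (∷⁺ʳ _ there) (kuroda-sound d₂)))
  kuroda-sound (⇒I d)       = jI (⇒I (kuroda-sound d))
  -- `j-⇒` turns `j (J φ ⇒ j (J ψ))` into `j (J φ) ⇒ j (J ψ)`, which accepts the translated minor
  -- premise.
  kuroda-sound (⇒E d d′)    = ⇒E (⇔E₂ j-⇒ (kuroda-sound d)) (kuroda-sound d′)
  kuroda-sound (∃I {x = x} {φ} t d) =
    jE (kuroda-sound d) (jI (∃I t (⇔E₂ (J-commutes φ x t) assume₀)))
  kuroda-sound (∃E {φ = φ} {ψ} x∉Γ x∉ψ d d′) = jE (kuroda-sound d)
    (∃E-independent (∉⇒independent (∉-remove (fv (J j φ))) ∷ J-independents x∉Γ)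
      (j-independent (J-independent ψ x∉ψ)) assume₀
      (weaken (∷⁺ʳ _ there) (kuroda-sound d′)))
  kuroda-sound (∀I x∉Γ d) = jI (∀I-independent (J-independents x∉Γ) (kuroda-sound d))
  kuroda-sound (∀E {x = x} {φ} t d) =
    -- `j-∀` removes the outer `j`, leaving a universal formula to instantiate; the substitution
    -- then moves inwards through `j` and `J`.
    ⇔E₁ (commutes _ _ _ ⟨⇔⟩ j-cong (J-commutes φ x t)) (∀E t (⇔E₂ j-∀ (kuroda-sound d)))

proposition4p2 : (S : Signature) (L : Logic) (j : Formula S → Formula S) → IsNucleus L j →
    ((φ : Formula S) → [] ⊢[ L ] gödelGentzen j φ ⇔ kuroda j φ)
    × ((Γ : List (Formula S)) (ψ : Formula S) → Γ ⊢[ L ] ψ → map (J j) Γ ⊢[ L ] kuroda j ψ)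
proposition4p2 S L j nucleus =
  gödelGentzen⇔kuroda nucleus , λ Γ ψ → kuroda-sound nucleus
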